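{- Let $A$ be the adjacency matrix of a graph $G$ and let $k\in\mathbb{N}$. Then the $k$-th moment $\varphi_e(A^k)$ of $A$ in $\varphi_e$ is sub-structure invariant: for every integer $K\ge1$, if $A_K$ denotes the adjacency matrix of the disjoint union $G\sqcup G\sqcup\cdots\sqcup G$ of $K$ copies of $G$, then $\varphi_e(A_K^k)=\varphi_e(A^k)$.
   Context: Graphs are finite, undirected, without loops (and simple), with nonempty vertex set; $\mathbb{N}=\{0,1,2,\ldots\}$. For an $N\times N$ complex matrix $B$ (any $N\ge1$), $\varphi_e(B)=\langle e,Be\rangle$ where $e=1_N/\|1_N\|_2$ and $1_N$ is the all-ones column vector in $\mathbb{C}^N$ (so $e$ is taken in the dimension matching the matrix). A property of graphs is called sub-structure invariant if the property of $G$ holds for $G\sqcup G\sqcup\cdots\sqcup G$, where $\sqcup$ is the disjoint union of graphs. -}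

module Defs where

open import Level using (_⊔_; 0ℓ) renaming (suc to lsuc)
open import Algebra.Apartness.Bundles using (HeytingField)
open import Algebra.Bundles using (CommutativeRing)
open import Algebra.Bundles.Raw using (RawMonoid)
import Algebra.Apartness.Properties.HeytingCommutativeRing as HeytingProperties
import Algebra.Definitions.RawMonoid as RawMonoidDefs
import Algebra.Properties.Ring as RingProperties
open import Data.Bool.Base using (if_then_else_)
open import Data.Fin.Base using (Fin; zero; suc; splitAt)
import Data.Fin.Properties as Fin
open import Data.Nat.Base as ℕ using (ℕ; zero; suc; NonZero)
open import Data.Product.Base using (∃-syntax; _×_; _,_; proj₁; proj₂)
open import Data.Sum.Base using (_⊎_; inj₁; inj₂)
open import Data.Sum.Relation.Binary.Pointwise
  using (Pointwise; ⊎-symmetric; ⊎-irreflexive; ⊎-decidable; ≡⇒Pointwise-≡)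
open import Data.Vec.Functional using (Vector)
open import Function.Base using (_∘_; _on_)
open import Relation.Binary.Core using (Rel)
open import Relation.Binary.Definitions
  using (Cotransitive; Decidable; Irreflexive; Symmetric)
open import Relation.Binary.PropositionalEquality.Core using (_≡_; cong)
open import Relation.Binary.Structures using (IsStrictPartialOrder)
open import Relation.Nullary.Decidable using (does)
open import Relation.Nullary.Negation using (¬_)

------------------------------------------------------------------------
-- Finite simple graphs

-- The vertex set is Fin order: an adjacency matrix presupposes a numbering
-- of the vertices.  Decidability of adjacency gives the 0/1 entries.

record Graph : Set₁ where
  infix 4 _~_ _~?_
  field
    order    : ℕ
    nonEmpty : NonZero order
    _~_      : Rel (Fin order) 0ℓ
    _~?_     : Decidable _~_
    ~-sym    : Symmetric _~_
    ~-irrefl : Irreflexive _≡_ _~_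

open Graph using (order; nonEmpty)

+-nonZeroˡ : ∀ {m} n → NonZero m → NonZero (m ℕ.+ n)
+-nonZeroˡ {suc m} n _ = _

-- splitAt identifies Fin (order G + order H) with Fin (order G) ⊎ Fin (order H);
-- Pointwise has no edges between the two summands.

infixr 6 _⊔ᴳ_

_⊔ᴳ_ : Graph → Graph → Graph
G ⊔ᴳ H = record
  { order    = order G ℕ.+ order H
  ; nonEmpty = +-nonZeroˡ (order H) (nonEmpty G)
  ; _~_      = Pointwise G._~_ H._~_ on splitAt (order G)
  ; _~?_     = λ i j → ⊎-decidable G._~?_ H._~?_ (splitAt (order G) i) (splitAt (order G) j)
  ; ~-sym    = ⊎-symmetric G.~-sym H.~-sym
  ; ~-irrefl = ⊎-irreflexive G.~-irrefl H.~-irrefl ∘ ≡⇒Pointwise-≡ ∘ cong (splitAt (order G))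
  }
  where
  module G = Graph G
  module H = Graph H

-- G ⊔ G ⊔ ⋯ ⊔ G with K ≥ 1 summands.

copies : (K : ℕ) → .{{NonZero K}} → Graph → Graph
copies 1             G = G
copies (suc (suc K)) G = G ⊔ᴳ copies (suc K) G

------------------------------------------------------------------------
-- The real numbers

-- The standard library has no type of real numbers.  They are characterised,
-- up to isomorphism, as the Cauchy complete Archimedean ordered field.
-- Equality is a setoid equality and inverses are taken of elements apart
-- from 0, so that Cauchy reals are a model without classical axioms.
-- Square roots follow from completeness; they are included as an operation
-- so that Euclidean norms can be written down directly.

record RealNumbers c ℓ₁ ℓ₂ : Set (lsuc (c ⊔ ℓ₁ ⊔ ℓ₂)) where
  field
    heytingField : HeytingField c ℓ₁ ℓ₂

  open HeytingField heytingField public renaming (Carrier to ℝ; zero to *-zero)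

  commutativeRing : CommutativeRing c ℓ₁
  commutativeRing = record { isCommutativeRing = isCommutativeRing }

  open CommutativeRing commutativeRing public using (+-rawMonoid; ring)
  open RawMonoidDefs +-rawMonoid public using (sum) renaming (_×_ to _×ᴿ_)

  infix 4 _<_ _≤_
  field
    _<_                  : Rel ℝ ℓ₂
    isStrictPartialOrder : IsStrictPartialOrder _≈_ _<_
    <-cotrans            : Cotransitive _<_
    #⇒<⊎>                : ∀ {x y} → x # y → x < y ⊎ y < x
    <⇒#                  : ∀ {x y} → x < y → x # y
    +-monoˡ-<            : ∀ {x y} z → x < y → x + z < y + z
    *-pos                : ∀ {x y} → 0# < x → 0# < y → 0# < x * y

  -- Constructively this is the right definition of ≤ on the reals; the
  -- disjunction x < y ⊎ x ≈ y would be too strong.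
  _≤_ : Rel ℝ ℓ₂
  x ≤ y = ¬ (y < x)

  -- As m and n range symmetrically, s m - s n < ε bounds the absolute value.
  Cauchy : (ℕ → ℝ) → Set _
  Cauchy s = ∀ ε → 0# < ε → ∃[ N ] (∀ m n → N ℕ.≤ m → N ℕ.≤ n → s m - s n < ε)

  _ConvergesTo_ : (ℕ → ℝ) → ℝ → Set _
  s ConvergesTo l =
    ∀ ε → 0# < ε → ∃[ N ] (∀ n → N ℕ.≤ n → (s n - l < ε) × (l - s n < ε))

  field
    archimedean : ∀ x → ∃[ n ] x < n ×ᴿ 1#
    complete    : ∀ s → Cauchy s → ∃[ l ] s ConvergesTo l
    sqrt        : ∀ x → 0# ≤ x → ℝ
    sqrt-nonneg : ∀ x (0≤x : 0# ≤ x) → 0# ≤ sqrt x 0≤x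
    sqrt-square : ∀ x (0≤x : 0# ≤ x) → sqrt x 0≤x * sqrt x 0≤x ≈ x

  open IsStrictPartialOrder isStrictPartialOrder public
    using (<-respʳ-≈; <-respˡ-≈)
    renaming (irrefl to <-irrefl; trans to <-trans)

  -- #⇒invertible inverts x - 0#.
  inv : ∀ x → x # 0# → ℝ
  inv x x#0 = proj₁ (#⇒invertible x#0)

  open HeytingProperties heytingCommutativeRing public
    using (1#0; x-0≈x; invertibleˡ⇒#; #-congʳ)
  open RingProperties ring
    using (-‿distribˡ-*; -‿distribʳ-*; -‿involutive)

  <0⇒0<- : ∀ {x} → x < 0# → 0# < - x
  <0⇒0<- {x} x<0 =
    <-respˡ-≈ (-‿inverseʳ x) (<-respʳ-≈ (+-identityˡ (- x)) (+-monoˡ-< (- x) x<0))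

  -x*-x≈x*x : ∀ x → (- x) * (- x) ≈ x * x
  -x*-x≈x*x x = trans (sym (-‿distribˡ-* x (- x)))
    (trans (-‿cong (sym (-‿distribʳ-* x x))) (-‿involutive (x * x)))

  #0⇒0<square : ∀ {x} → x # 0# → 0# < x * x
  #0⇒0<square {x} x#0 with #⇒<⊎> x#0
  ... | inj₁ x<0 = <-respʳ-≈ (-x*-x≈x*x x) (*-pos (<0⇒0<- x<0) (<0⇒0<- x<0))
  ... | inj₂ 0<x = *-pos 0<x 0<x

  square#0⇒#0 : ∀ {x} → x * x # 0# → x # 0#
  square#0⇒#0 {x} xx#0 with #⇒invertible xx#0
  ... | y , y*xx≈1 , _ = invertibleˡ⇒# (y * x ,
    trans (*-congˡ (x-0≈x x))
      (trans (*-assoc y x x) (trans (*-congˡ (sym (x-0≈x (x * x)))) y*xx≈1)))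

  0≤square : ∀ x → 0# ≤ x * x
  0≤square x xx<0 =
    <-irrefl refl (<-trans xx<0 (#0⇒0<square (square#0⇒#0 (<⇒# xx<0))))

  0<1 : 0# < 1#
  0<1 = <-respʳ-≈ (*-identityˡ 1#) (#0⇒0<square 1#0)

  x+y-x≈y : ∀ x y → (x + y) + - x ≈ y
  x+y-x≈y x y = trans (+-congʳ (+-comm x y))
    (trans (+-assoc y x (- x)) (trans (+-congˡ (-‿inverseʳ x)) (+-identityʳ y)))

  0≤+ : ∀ {x y} → 0# ≤ x → 0# ≤ y → 0# ≤ x + y
  0≤+ {x} {y} 0≤x 0≤y x+y<0 with <-cotrans x+y<0 x
  ... | inj₁ x+y<x = 0≤y (<-respˡ-≈ (x+y-x≈y x y)
                            (<-respʳ-≈ (-‿inverseʳ x) (+-monoˡ-< (- x) x+y<x)))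
  ... | inj₂ x<0   = 0≤x x<0

  0<+ : ∀ {x y} → 0# < x → 0# < y → 0# < x + y
  0<+ {x} {y} 0<x 0<y = <-trans 0<y (<-respˡ-≈ (+-identityˡ y) (+-monoˡ-< y 0<x))

  0≤sum : ∀ {n} (v : Vector ℝ n) → (∀ i → 0# ≤ v i) → 0# ≤ sum v
  0≤sum {zero}  v 0≤v = <-irrefl refl
  0≤sum {suc n} v 0≤v = 0≤+ (0≤v zero) (0≤sum (v ∘ suc) (0≤v ∘ suc))

  0<sum : ∀ {n} .{{_ : NonZero n}} (v : Vector ℝ n) → (∀ i → 0# < v i) → 0# < sum v
  0<sum {1}           v 0<v = <-respʳ-≈ (sym (+-identityʳ (v zero))) (0<v zero)
  0<sum {suc (suc n)} v 0<v = 0<+ (0<v zero) (0<sum (v ∘ suc) (0<v ∘ suc))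

------------------------------------------------------------------------
-- Complex matrices

module ComplexMatrices {c ℓ₁ ℓ₂} (R : RealNumbers c ℓ₁ ℓ₂) where

  private module R = RealNumbers R

  record ℂ : Set c where
    constructor _+i_
    field
      re : R.ℝ
      im : R.ℝ

  open ℂ public

  infix  4 _≈_
  infixl 6 _+_
  infixl 7 _*_

  _≈_ : Rel ℂ ℓ₁
  z ≈ w = (re z R.≈ re w) × (im z R.≈ im w)

  0ℂ 1ℂ : ℂ
  0ℂ = R.0# +i R.0#
  1ℂ = R.1# +i R.0#

  _+_ _*_ : ℂ → ℂ → ℂ
  z + w = (re z R.+ re w) +i (im z R.+ im w)
  z * w = (re z R.* re w R.- im z R.* im w) +i (re z R.* im w R.+ im z R.* re w)

  conj : ℂ → ℂ
  conj z = re z +i (R.- im z)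

  -- |z|²
  ∣_∣² : ℂ → R.ℝ
  ∣ z ∣² = re z R.* re z R.+ im z R.* im z

  0≤∣_∣² : ∀ z → R.0# R.≤ ∣ z ∣²
  0≤∣ z ∣² = R.0≤+ (R.0≤square (re z)) (R.0≤square (im z))

  +-rawMonoid : RawMonoid c ℓ₁
  +-rawMonoid = record { Carrier = ℂ ; _≈_ = _≈_ ; _∙_ = _+_ ; ε = 0ℂ }

  open RawMonoidDefs +-rawMonoid public using (sum)

  Matrix : ℕ → Set c
  Matrix N = Fin N → Fin N → ℂ

  identity : ∀ {N} → Matrix N
  identity i j = if does (i Fin.≟ j) then 1ℂ else 0ℂ

  infixl 7 _⊗_ _⊛_
  infixr 8 _^_

  _⊗_ : ∀ {N} → Matrix N → Matrix N → Matrix N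
  (A ⊗ B) i j = sum λ l → A i l * B l j

  _^_ : ∀ {N} → Matrix N → ℕ → Matrix N
  A ^ zero  = identity
  A ^ suc k = A ⊗ A ^ k

  _⊛_ : ∀ {N} → Matrix N → Vector ℂ N → Vector ℂ N
  (A ⊛ v) i = sum λ j → A i j * v j

  -- Conjugate-linear in the first argument.
  ⟨_,_⟩ : ∀ {N} → Vector ℂ N → Vector ℂ N → ℂ
  ⟨ u , v ⟩ = sum λ i → conj (u i) * v i

  ‖_‖₂ : ∀ {N} → Vector ℂ N → R.ℝ
  ‖ v ‖₂ = R.sqrt (R.sum λ i → ∣ v i ∣²) (R.0≤sum _ λ i → 0≤∣ v i ∣²)

  _/_[_] : ∀ {N} → Vector ℂ N → (r : R.ℝ) → r R.# R.0# → Vector ℂ N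
  (v / r [ r#0 ]) i = (R.inv r r#0 +i R.0#) * v i

  ones : ∀ N → Vector ℂ N
  ones N _ = 1ℂ

  ‖ones‖#0 : ∀ N .{{_ : NonZero N}} → ‖ ones N ‖₂ R.# R.0#
  ‖ones‖#0 N = R.square#0⇒#0 (R.#-congʳ (R.sym (R.sqrt-square _ _))
    (R.#-sym (R.<⇒# (R.0<sum (λ i → ∣ ones N i ∣²) λ _ → 0<∣1∣²))))
    where
    0<∣1∣² : R.0# R.< ∣ 1ℂ ∣²
    0<∣1∣² = R.<-respʳ-≈
      (R.sym (R.trans (R.+-cong (R.*-identityˡ R.1#) (R.zeroˡ R.0#)) (R.+-identityʳ R.1#)))
      R.0<1

  e : ∀ N .{{_ : NonZero N}} → Vector ℂ N
  e N = ones N / ‖ ones N ‖₂ [ ‖ones‖#0 N ]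

  φₑ : ∀ {N} .{{_ : NonZero N}} → Matrix N → ℂ
  φₑ {N} B = ⟨ e N , B ⊛ e N ⟩

  adjacency : (G : Graph) → Matrix (order G)
  adjacency G i j = if does (Graph._~?_ G i j) then 1ℂ else 0ℂ

{-# OPTIONS --safe #-}

-- For an N × N matrix B, φₑ(B) is the sum of the entries of B divided by N.
-- There are no edges between the summands of a disjoint union, so multiplication
-- by its adjacency matrix, and hence by any power of it, commutes with restricting
-- vectors to a summand.  Applied to the all-ones vector, this makes the entry sum
-- of the k-th power additive over disjoint unions, like N itself, and the quotient
-- of the two is the same for K copies as for one.

module Submission where

open import Defs
open import Data.Nat.Base using (ℕ; NonZero)

open import Algebra.Bundles using (CommutativeRing; CommutativeSemiring)
open import Algebra.Structures using (IsCommutativeSemiring)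
open import Algebra.Structures.Biased using (isCommutativeSemiringˡ)
import Algebra.Properties.CommutativeMonoid.Sum as CommutativeMonoidSum
import Algebra.Properties.CommutativeSemigroup as CommutativeSemigroupProperties
import Algebra.Properties.Ring as RingProperties
import Algebra.Properties.Semiring.Sum as SemiringSum
import Algebra.Solver.Ring.NaturalCoefficients.Default as NaturalCoefficients
open import Data.Fin.Base using (Fin; zero; suc; _↑ˡ_; _↑ʳ_)
open import Data.Fin.Properties using (splitAt-↑ˡ; splitAt-↑ʳ)
import Data.Nat.Base as ℕ
open import Data.Product.Base using (_,_; proj₁; proj₂)
open import Data.Vec.Functional using (Vector)
open import Function.Base using (_∘_)
open import Relation.Binary.PropositionalEquality.Core as ≡ using (_≡_)
import Relation.Binary.Reasoning.Setoid as SetoidReasoning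
open import Relation.Binary.Structures using (IsEquivalence)

open Graph using (order; nonEmpty)

module _ {c ℓ₁ ℓ₂} (R : RealNumbers c ℓ₁ ℓ₂) where

  open ComplexMatrices R hiding (module ℂ)
  private module R = RealNumbers R

  open RingProperties R.ring using (-1*x≈-x)
  open NaturalCoefficients (CommutativeRing.commutativeSemiring R.commutativeRing)
    using (solve; _:+_; _:*_; _:=_)

  -- Commutative semiring structure of the complex numbers.

  ℂ-isCommutativeSemiring : IsCommutativeSemiring _≈_ _+_ _*_ 0ℂ 1ℂ
  ℂ-isCommutativeSemiring = isCommutativeSemiringˡ record
    { +-isCommutativeMonoid = record
      { isMonoid = record
        { isSemigroup = record
          { isMagma = record
            { isEquivalence = ≈-isEquivalence
            ; ∙-cong = λ (p , p′) (q , q′) → R.+-cong p q , R.+-cong p′ q′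
            }
          ; assoc = λ x y z → R.+-assoc _ _ _ , R.+-assoc _ _ _
          }
        ; identity = (λ x → R.+-identityˡ _ , R.+-identityˡ _)
                   , (λ x → R.+-identityʳ _ , R.+-identityʳ _)
        }
      ; comm = λ x y → R.+-comm _ _ , R.+-comm _ _
      }
    ; *-isCommutativeMonoid = record
      { isMonoid = record
        { isSemigroup = record
          { isMagma = record
            { isEquivalence = ≈-isEquivalence
            ; ∙-cong = λ (p , p′) (q , q′) →
                R.+-cong (R.*-cong p q) (R.-‿cong (R.*-cong p′ q′)) ,
                R.+-cong (R.*-cong p q′) (R.*-cong p′ q)
            }
          ; assoc = λ (a +i b) (c +i d) (e +i f) →
              R.trans (R.trans (-≈+u* _ _) (R.+-congʳ (R.*-congʳ (-≈+u* _ _))))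
                (R.trans
                  (solve 7 (λ a b c d e f u →
                    ((a :* c :+ u :* (b :* d)) :* e :+ u :* ((a :* d :+ b :* c) :* f)) :=
                    (a :* (c :* e :+ u :* (d :* f)) :+ u :* (b :* (c :* f :+ d :* e))))
                    R.refl a b c d e f u)
                  (R.sym (R.trans (-≈+u* _ _) (R.+-congʳ (R.*-congˡ (-≈+u* _ _)))))) ,
              R.trans (R.+-congʳ (R.*-congʳ (-≈+u* _ _)))
                (R.trans
                  (solve 7 (λ a b c d e f u →
                    ((a :* c :+ u :* (b :* d)) :* f :+ (a :* d :+ b :* c) :* e) :=
                    (a :* (c :* f :+ d :* e) :+ b :* (c :* e :+ u :* (d :* f))))
                    R.refl a b c d e f u)
                  (R.sym (R.+-congˡ (R.*-congˡ (-≈+u* _ _)))))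
          }
        ; identity = *-identityˡ , λ x → ≈-trans (*-comm x 1ℂ) (*-identityˡ x)
        }
      ; comm = *-comm
      }
    ; distribʳ = λ (a +i b) (c +i d) (e +i f) →
        R.trans (-≈+u* _ _)
          (R.trans
            (solve 7 (λ a b c d e f u →
              ((c :+ e) :* a :+ u :* ((d :+ f) :* b)) :=
              ((c :* a :+ u :* (d :* b)) :+ (e :* a :+ u :* (f :* b))))
              R.refl a b c d e f u)
            (R.sym (R.+-cong (-≈+u* _ _) (-≈+u* _ _)))) ,
        solve 6 (λ a b c d e f →
          ((c :+ e) :* b :+ (d :+ f) :* a) :=
          ((c :* b :+ d :* a) :+ (e :* b :+ f :* a)))
          R.refl a b c d e f
    ; zeroˡ = λ (a +i b) →
        R.trans (R.+-cong (R.zeroˡ a) (R.-‿cong (R.zeroˡ b))) (R.-‿inverseʳ R.0#) ,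
        R.trans (R.+-cong (R.zeroˡ b) (R.zeroˡ a)) (R.+-identityˡ R.0#)
    }
    where
    -- With -1 replaced by an indeterminate u, the laws are semiring identities
    -- (those of R[√u]), so the solver need not handle negation.
    u : R.ℝ
    u = R.- R.1#

    -≈+u* : ∀ x y → x R.- y R.≈ x R.+ u R.* y
    -≈+u* x y = R.+-congˡ (R.sym (-1*x≈-x y))

    ≈-trans : ∀ {x y z} → x ≈ y → y ≈ z → x ≈ z
    ≈-trans (p , p′) (q , q′) = R.trans p q , R.trans p′ q′

    ≈-isEquivalence : IsEquivalence _≈_
    ≈-isEquivalence = record
      { refl  = R.refl , R.refl
      ; sym   = λ (p , p′) → R.sym p , R.sym p′
      ; trans = ≈-trans
      }

    *-comm : ∀ x y → x * y ≈ y * x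
    *-comm (a +i b) (c +i d) =
      R.+-cong (R.*-comm a c) (R.-‿cong (R.*-comm b d)) ,
      R.trans (R.+-comm _ _) (R.+-cong (R.*-comm b c) (R.*-comm a d))

    *-identityˡ : ∀ x → 1ℂ * x ≈ x
    *-identityˡ (a +i b) =
      R.trans (R.+-cong (R.*-identityˡ a) (R.-‿cong (R.zeroˡ b))) (R.x-0≈x a) ,
      R.trans (R.+-cong (R.*-identityˡ b) (R.zeroˡ a)) (R.+-identityʳ b)

  ℂ-commutativeSemiring : CommutativeSemiring c ℓ₁
  ℂ-commutativeSemiring = record { isCommutativeSemiring = ℂ-isCommutativeSemiring }

  private module ℂ = CommutativeSemiring ℂ-commutativeSemiring
  open CommutativeMonoidSum ℂ.+-commutativeMonoid using (sum-cong-≋; ∑-comm)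
  open SemiringSum ℂ.semiring using (*-distribˡ-sum; *-distribʳ-sum)
  open CommutativeSemigroupProperties ℂ.*-commutativeSemigroup using (x∙yz≈y∙xz; xy∙z≈xz∙y)
  open SetoidReasoning ℂ.setoid

  -- Finite sums and the action of matrices on vectors.

  sum-++ : ∀ m {n} (v : Vector ℂ (m ℕ.+ n)) →
           sum v ≈ sum (v ∘ (_↑ˡ n)) + sum (v ∘ (m ↑ʳ_))
  sum-++ ℕ.zero    v = ℂ.sym (ℂ.+-identityˡ _)
  sum-++ (ℕ.suc m) v = ℂ.trans (ℂ.+-congˡ (sum-++ m (v ∘ suc))) (ℂ.sym (ℂ.+-assoc _ _ _))

  sum-0* : ∀ {n} (v : Vector ℂ n) → sum (λ j → 0ℂ * v j) ≈ 0ℂ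
  sum-0* v = ℂ.trans (ℂ.sym (*-distribˡ-sum 0ℂ v)) (ℂ.zeroˡ _)

  ⊛-cong : ∀ {N} (A : Matrix N) {u v : Vector ℂ N} →
           (∀ j → u j ≈ v j) → ∀ i → (A ⊛ u) i ≈ (A ⊛ v) i
  ⊛-cong A u≈v i = sum-cong-≋ λ j → ℂ.*-congˡ (u≈v j)

  -- Induction works because `suc i Fin.≟ suc j` has the same `does` as `i Fin.≟ j`: past its first
  -- entry, row `suc i` is row `i` of the smaller identity matrix by computation.
  identity-⊛ : ∀ {N} (v : Vector ℂ N) i → (identity ⊛ v) i ≈ v i
  identity-⊛ v zero =
    ℂ.trans (ℂ.+-cong (ℂ.*-identityˡ (v zero)) (sum-0* (v ∘ suc))) (ℂ.+-identityʳ (v zero))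
  identity-⊛ v (suc i) =
    ℂ.trans (ℂ.+-cong (ℂ.zeroˡ (v zero)) (identity-⊛ (v ∘ suc) i)) (ℂ.+-identityˡ (v (suc i)))

  ⊗-⊛-assoc : ∀ {N} (A B : Matrix N) v i → ((A ⊗ B) ⊛ v) i ≈ (A ⊛ (B ⊛ v)) i
  ⊗-⊛-assoc A B v i = begin
    sum (λ j → sum (λ l → A i l * B l j) * v j)
      ≈⟨ (sum-cong-≋ λ j → ℂ.trans (*-distribʳ-sum (v j) (λ l → A i l * B l j))
                                   (sum-cong-≋ λ l → ℂ.*-assoc (A i l) (B l j) (v j))) ⟩
    sum (λ j → sum (λ l → A i l * (B l j * v j)))
      ≈⟨ ∑-comm (λ j l → A i l * (B l j * v j)) ⟩
    sum (λ l → sum (λ j → A i l * (B l j * v j)))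
      ≈⟨ (sum-cong-≋ λ l → *-distribˡ-sum (A i l) (λ j → B l j * v j)) ⟨
    sum (λ l → A i l * sum (λ j → B l j * v j)) ∎

  -- With f* denoting the restriction of vectors along `f`, this is the operator identity f* B = A
  -- f*. It is stated through actions on vectors so that it passes to powers.
  IntertwinedBy : ∀ {m n} → (Fin m → Fin n) → Matrix m → Matrix n → Set _
  IntertwinedBy f A B = ∀ v i → (B ⊛ v) (f i) ≈ (A ⊛ (v ∘ f)) i

  ^-intertwinedBy : ∀ {m n} {f : Fin m → Fin n} {A : Matrix m} {B : Matrix n} →
                    IntertwinedBy f A B → ∀ k → IntertwinedBy f (A ^ k) (B ^ k)
  ^-intertwinedBy {f = f} AfB ℕ.zero v i =
    ℂ.trans (identity-⊛ v (f i)) (ℂ.sym (identity-⊛ (v ∘ f) i))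
  ^-intertwinedBy {f = f} {A} {B} AfB (ℕ.suc k) v i = begin
    ((B ⊗ B ^ k) ⊛ v) (f i)      ≈⟨ ⊗-⊛-assoc B (B ^ k) v (f i) ⟩
    -- The hypothesis is applied to the vector `B ^ k ⊛ v`; this is where its validity for every
    -- vector matters.
    (B ⊛ (B ^ k ⊛ v)) (f i)      ≈⟨ AfB (B ^ k ⊛ v) i ⟩
    (A ⊛ ((B ^ k ⊛ v) ∘ f)) i    ≈⟨ ⊛-cong A (^-intertwinedBy AfB k v) i ⟩
    (A ⊛ (A ^ k ⊛ (v ∘ f))) i    ≈⟨ ⊗-⊛-assoc A (A ^ k) (v ∘ f) i ⟨
    ((A ⊗ A ^ k) ⊛ (v ∘ f)) i    ∎

  -- Block structure of the adjacency matrix of a disjoint union.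

  module _ (G H : Graph) where

    private
      m = order G
      n = order H

    -- Once `splitAt` is evaluated at injected indices, `⊎-decidable` computes: within a summand it
    -- decides as that summand does, and across summands it refuses. Hence all four blocks are known
    -- up to propositional equality.
    adjacency-↑ˡ-↑ˡ : ∀ i j → adjacency (G ⊔ᴳ H) (i ↑ˡ n) (j ↑ˡ n) ≡ adjacency G i j
    adjacency-↑ˡ-↑ˡ i j rewrite splitAt-↑ˡ m i n | splitAt-↑ˡ m j n = ≡.refl

    adjacency-↑ˡ-↑ʳ : ∀ i j → adjacency (G ⊔ᴳ H) (i ↑ˡ n) (m ↑ʳ j) ≡ 0ℂ
    adjacency-↑ˡ-↑ʳ i j rewrite splitAt-↑ˡ m i n | splitAt-↑ʳ m n j = ≡.refl

    adjacency-↑ʳ-↑ˡ : ∀ i j → adjacency (G ⊔ᴳ H) (m ↑ʳ i) (j ↑ˡ n) ≡ 0ℂ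
    adjacency-↑ʳ-↑ˡ i j rewrite splitAt-↑ʳ m n i | splitAt-↑ˡ m j n = ≡.refl

    adjacency-↑ʳ-↑ʳ : ∀ i j → adjacency (G ⊔ᴳ H) (m ↑ʳ i) (m ↑ʳ j) ≡ adjacency H i j
    adjacency-↑ʳ-↑ʳ i j rewrite splitAt-↑ʳ m n i | splitAt-↑ʳ m n j = ≡.refl

    -- A row through a vertex of `G` consists of a row of `adjacency G` followed by zeros, so only
    -- the restriction of `v` to `G` contributes.
    adjacency-⊔ˡ : IntertwinedBy (_↑ˡ n) (adjacency G) (adjacency (G ⊔ᴳ H))
    adjacency-⊔ˡ v i = begin
      (adjacency (G ⊔ᴳ H) ⊛ v) (i ↑ˡ n)
        ≈⟨ sum-++ m _ ⟩
      sum (λ j → adjacency (G ⊔ᴳ H) (i ↑ˡ n) (j ↑ˡ n) * v (j ↑ˡ n)) +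
      sum (λ j → adjacency (G ⊔ᴳ H) (i ↑ˡ n) (m ↑ʳ j) * v (m ↑ʳ j))
        ≈⟨ ℂ.+-cong (sum-cong-≋ λ j → ℂ.*-congʳ (ℂ.reflexive (adjacency-↑ˡ-↑ˡ i j)))
                    (sum-cong-≋ λ j → ℂ.*-congʳ (ℂ.reflexive (adjacency-↑ˡ-↑ʳ i j))) ⟩
      (adjacency G ⊛ (v ∘ (_↑ˡ n))) i + sum (λ j → 0ℂ * v (m ↑ʳ j))
        ≈⟨ ℂ.+-congˡ (sum-0* (v ∘ (m ↑ʳ_))) ⟩
      (adjacency G ⊛ (v ∘ (_↑ˡ n))) i + 0ℂ
        ≈⟨ ℂ.+-identityʳ _ ⟩
      (adjacency G ⊛ (v ∘ (_↑ˡ n))) i ∎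

    adjacency-⊔ʳ : IntertwinedBy (m ↑ʳ_) (adjacency H) (adjacency (G ⊔ᴳ H))
    adjacency-⊔ʳ v i = begin
      (adjacency (G ⊔ᴳ H) ⊛ v) (m ↑ʳ i)
        ≈⟨ sum-++ m _ ⟩
      sum (λ j → adjacency (G ⊔ᴳ H) (m ↑ʳ i) (j ↑ˡ n) * v (j ↑ˡ n)) +
      sum (λ j → adjacency (G ⊔ᴳ H) (m ↑ʳ i) (m ↑ʳ j) * v (m ↑ʳ j))
        ≈⟨ ℂ.+-cong (sum-cong-≋ λ j → ℂ.*-congʳ (ℂ.reflexive (adjacency-↑ʳ-↑ˡ i j)))
                    (sum-cong-≋ λ j → ℂ.*-congʳ (ℂ.reflexive (adjacency-↑ʳ-↑ʳ i j))) ⟩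
      sum (λ j → 0ℂ * v (j ↑ˡ n)) + (adjacency H ⊛ (v ∘ (m ↑ʳ_))) i
        ≈⟨ ℂ.+-congʳ (sum-0* (v ∘ (_↑ˡ n))) ⟩
      0ℂ + (adjacency H ⊛ (v ∘ (m ↑ʳ_))) i
        ≈⟨ ℂ.+-identityˡ _ ⟩
      (adjacency H ⊛ (v ∘ (m ↑ʳ_))) i ∎

  -- Entry sums of powers over disjoint unions.

  entrySum : ∀ {N} → Matrix N → ℂ
  entrySum {N} B = sum (B ⊛ ones N)

  entrySum-⊔ : ∀ G H k → entrySum (adjacency (G ⊔ᴳ H) ^ k) ≈
                         entrySum (adjacency G ^ k) + entrySum (adjacency H ^ k)
  entrySum-⊔ G H k = ℂ.trans (sum-++ (order G) _) (ℂ.+-cong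
    -- The restriction of `ones` to either summand is again `ones`, by computation.
    (sum-cong-≋ (^-intertwinedBy {A = adjacency G} (adjacency-⊔ˡ G H) k (ones _)))
    (sum-cong-≋ (^-intertwinedBy {A = adjacency H} (adjacency-⊔ʳ G H) k (ones _))))

  -- Both the entry sum and the number of vertices are additive, so a common factor `x` survives the
  -- induction. Writing the ratio as a product avoids division.
  entrySum-copies : ∀ G k K .{{_ : NonZero K}} {x} →
    entrySum (adjacency G ^ k) ≈ x * sum (ones (order G)) →
    entrySum (adjacency (copies K G) ^ k) ≈ x * sum (ones (order (copies K G)))
  entrySum-copies G k 1 eq = eq
  entrySum-copies G k (ℕ.suc (ℕ.suc K)) {x} eq = begin
    entrySum (adjacency (G ⊔ᴳ copies (ℕ.suc K) G) ^ k)
      ≈⟨ entrySum-⊔ G (copies (ℕ.suc K) G) k ⟩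
    entrySum (adjacency G ^ k) + entrySum (adjacency (copies (ℕ.suc K) G) ^ k)
      ≈⟨ ℂ.+-cong eq (entrySum-copies G k (ℕ.suc K) eq) ⟩
    x * sum (ones (order G)) + x * sum (ones (order (copies (ℕ.suc K) G)))
      ≈⟨ ℂ.distribˡ x _ _ ⟨
    x * (sum (ones (order G)) + sum (ones (order (copies (ℕ.suc K) G))))
      ≈⟨ ℂ.*-congˡ (sum-++ (order G) (ones _)) ⟨
    x * sum (ones (order (G ⊔ᴳ copies (ℕ.suc K) G))) ∎

  -- Normalisation of the vector `e`.

  fromReal : R.ℝ → ℂ
  fromReal r = r +i R.0#

  fromReal-* : ∀ r s → fromReal r * fromReal s ≈ fromReal (r R.* s)
  fromReal-* r s =
    R.trans (R.+-congˡ (R.-‿cong (R.zeroˡ R.0#))) (R.x-0≈x (r R.* s)) ,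
    R.trans (R.+-cong (R.zeroʳ r) (R.zeroˡ s)) (R.+-identityˡ R.0#)

  conj-fromReal : ∀ {z r} → z ≈ fromReal r → conj z ≈ fromReal r
  conj-fromReal (re≈ , im≈) =
    re≈ , R.trans (R.-‿cong im≈) (R.trans (R.sym (R.+-identityˡ _)) (R.-‿inverseʳ R.0#))

  -- Links the dimension, as a complex number, to the real number under the root in `‖ ones n ‖₂`.
  sum-ones : ∀ n → sum (ones n) ≈ fromReal (R.sum λ i → ∣ ones n i ∣²)
  sum-ones ℕ.zero    = ℂ.refl
  sum-ones (ℕ.suc n) =
    R.+-cong (R.sym (R.trans (R.+-cong (R.*-identityˡ R.1#) (R.zeroˡ R.0#)) (R.+-identityʳ R.1#)))
             (proj₁ (sum-ones n)) ,
    R.trans (R.+-congˡ (proj₂ (sum-ones n))) (R.+-identityˡ R.0#)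

  module _ (N : ℕ) .{{_ : NonZero N}} where

    private
      x y : R.ℝ
      x = ‖ ones N ‖₂
      y = R.inv x (‖ones‖#0 N)

      -- The common entry of `e N`, left with its factor `1ℂ` so that it agrees with `e N` by
      -- computation.
      ε : ℂ
      ε = fromReal y * 1ℂ

      yx≈1 : y R.* x R.≈ R.1#
      yx≈1 = R.trans (R.*-congˡ (R.sym (R.x-0≈x x))) (proj₁ (proj₂ (R.#⇒invertible (‖ones‖#0 N))))

    -- This is 1/N, the squared modulus of an entry of `e N`.
    weight : ℂ
    weight = conj ε * ε

    φₑ≈weight*entrySum : ∀ B → φₑ B ≈ weight * entrySum B
    φₑ≈weight*entrySum B = begin
      sum (λ i → conj ε * sum (λ j → B i j * ε))
        ≈⟨ *-distribˡ-sum (conj ε) (λ i → sum (λ j → B i j * ε)) ⟨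
      conj ε * sum (λ i → sum (λ j → B i j * ε))
        ≈⟨ ℂ.*-congˡ (sum-cong-≋ λ i → ℂ.trans
             -- The factor 1 inserted here becomes the entry of `ones` once `ε` is moved to the
             -- front.
             (sum-cong-≋ λ j → ℂ.trans (ℂ.*-congˡ (ℂ.sym (ℂ.*-identityʳ ε))) (x∙yz≈y∙xz (B i j) ε 1ℂ))
             (ℂ.sym (*-distribˡ-sum ε (λ j → B i j * 1ℂ)))) ⟩
      conj ε * sum (λ i → ε * (B ⊛ ones N) i)
        ≈⟨ ℂ.*-congˡ (*-distribˡ-sum ε (B ⊛ ones N)) ⟨
      conj ε * (ε * entrySum B)
        ≈⟨ ℂ.*-assoc (conj ε) ε (entrySum B) ⟨
      weight * entrySum B ∎

    weight*sum-ones≈1 : weight * sum (ones N) ≈ 1ℂ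
    weight*sum-ones≈1 = begin
      weight * sum (ones N)
        ≈⟨ ℂ.*-cong (ℂ.*-cong (conj-fromReal ε≈y) ε≈y) (sum-ones N) ⟩
      fromReal y * fromReal y * fromReal (R.sum λ i → ∣ ones N i ∣²)
        -- The sum under the root becomes `x R.* x`, the square of the norm that `y` inverts.
        ≈⟨ ℂ.*-cong (fromReal-* y y) (R.sym (R.sqrt-square _ _) , R.refl) ⟩
      fromReal (y R.* y) * fromReal (x R.* x)
        ≈⟨ fromReal-* (y R.* y) (x R.* x) ⟩
      fromReal (y R.* y R.* (x R.* x))
        ≈⟨ solve 2 (λ x y → (y :* y :* (x :* x)) := (y :* x :* (y :* x))) R.refl x y , R.refl ⟩
      fromReal (y R.* x R.* (y R.* x))
        ≈⟨ R.trans (R.*-cong yx≈1 yx≈1) (R.*-identityˡ R.1#) , R.refl ⟩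
      1ℂ ∎
      where
      ε≈y : ε ≈ fromReal y
      ε≈y = ℂ.*-identityʳ (fromReal y)

    entrySum≈φₑ*sum-ones : ∀ B → entrySum B ≈ φₑ B * sum (ones N)
    entrySum≈φₑ*sum-ones B = begin
      entrySum B                           ≈⟨ ℂ.*-identityˡ _ ⟨
      1ℂ * entrySum B                      ≈⟨ ℂ.*-congʳ weight*sum-ones≈1 ⟨
      weight * sum (ones N) * entrySum B   ≈⟨ xy∙z≈xz∙y weight (sum (ones N)) (entrySum B) ⟩
      weight * entrySum B * sum (ones N)   ≈⟨ ℂ.*-congʳ (φₑ≈weight*entrySum B) ⟨
      φₑ B * sum (ones N)                  ∎

    -- Multiplication by `weight` cancels `sum (ones N)`. Together with `entrySum≈φₑ*sum-ones` this
    -- characterises `φₑ B` as the ratio of entry sum to dimension.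
    φₑ-unique : ∀ {z} B → entrySum B ≈ z * sum (ones N) → φₑ B ≈ z
    φₑ-unique {z} B eq = begin
      φₑ B                          ≈⟨ φₑ≈weight*entrySum B ⟩
      weight * entrySum B           ≈⟨ ℂ.*-congˡ eq ⟩
      weight * (z * sum (ones N))   ≈⟨ x∙yz≈y∙xz weight z (sum (ones N)) ⟩
      z * (weight * sum (ones N))   ≈⟨ ℂ.*-congˡ weight*sum-ones≈1 ⟩
      z * 1ℂ                        ≈⟨ ℂ.*-identityʳ z ⟩
      z                             ∎

corollary3p20 : ∀ {c ℓ₁ ℓ₂} (R : RealNumbers c ℓ₁ ℓ₂) (G : Graph) (k K : ℕ) .{{_ : NonZero K}} →
    let open ComplexMatrices R in
    φₑ {{Graph.nonEmpty (copies K G)}} (adjacency (copies K G) ^ k) ≈ φₑ {{Graph.nonEmpty G}} (adjacency G ^ k)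
corollary3p20 R G k K =
  -- The ratio carried through the copies is the moment of `G` itself; uniqueness in the larger
  -- dimension identifies it with the moment of the union.
  φₑ-unique R (order (copies K G)) {{nonEmpty (copies K G)}} (adjacency (copies K G) ^ k)
    (entrySum-copies R G k K
      (entrySum≈φₑ*sum-ones R (order G) {{nonEmpty G}} (adjacency G ^ k)))
  where open ComplexMatrices R
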